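{- Let $c_0$ be a proper $4$-colouring of the plane, let $\mu$ be a left-invariant finitely additive probability measure on $S_4\times E(2)$, and let $p_d$ be the associated monochromaticity probabilities (see context). Then $$p_{\frac{\sqrt6-\sqrt2}{2}}\ge\frac{13}{150}.$$
   Context: Identify the plane with $\mathbb C$. A proper $4$-colouring of the plane is a map $c_0:\mathbb C\to\{1,2,3,4\}$ such that no two points at distance $1$ have the same colour. Let $S_4$ be the group of permutations of the colours and $E(2)$ the group of Euclidean isometries of the plane. The group $S_4\times E(2)$ is amenable, so there is a finitely additive probability measure $\mu$ defined on all subsets of $S_4\times E(2)$ which is left-invariant, i.e. $\mu(gE)=\mu(E)$ for all $g\in S_4\times E(2)$ and $E\subseteq S_4\times E(2)$. For $(\sigma,T)\in S_4\times E(2)$ consider the (random) colouring $c=\sigma\circ c_0\circ T^{ -1}$. For $d\ge 0$, $p_d$ denotes the probability that two points $A,B$ at distance $d$ get the same colour: $p_d=\mu(\{(\sigma,T): c(A)=c(B)\})$; by left-invariance this does not depend on the choice of $A,B$ with $|AB|=d$. The existence of $c_0$ is a standing assumption, and $c_0,\mu$ are arbitrary but fixed. -}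

module Defs where

open import Algebra.Bundles using (Group; CommutativeRing)
import Algebra.Construct.DirectProduct as DirectProduct
import Algebra.Properties.Monoid.Mult as Mult
import Algebra.Solver.Ring.NaturalCoefficients.Default as SemiringSolver
open import Data.Empty using (⊥-elim)
open import Data.Fin.Base using (Fin)
open import Data.Nat.Base using (ℕ)
open import Data.Product.Base using (Σ; ∃; _×_; _,_; proj₁; proj₂)
open import Data.Product.Relation.Binary.Pointwise.NonDependent using (×-setoid)
open import Data.Sum.Base using (inj₁; inj₂)
open import Function.Bundles using (Func; Inverse)
import Function.Construct.Composition as Composition
import Function.Construct.Identity as Identity
import Function.Construct.Symmetry as Symmetry
open import Level using (0ℓ)
open import Relation.Binary.Bundles using (Setoid; Poset)
open import Relation.Binary.Core using (Rel)
open import Relation.Binary.Definitions using (_Respects_)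
import Relation.Binary.PropositionalEquality as ≡
open ≡ using (_≡_; _≢_)
open import Relation.Binary.Structures using (IsDecTotalOrder)
import Relation.Binary.Reasoning.PartialOrder as PosetReasoning
open import Relation.Nullary using (yes; no)
open import Relation.Unary using (Pred; Satisfiable; U; _∪_; _∩_; Empty; _≐_)

-- The real numbers are axiomatised as a Dedekind-complete ordered field;
-- classically this determines them up to a unique isomorphism.

record CompleteOrderedField : Set₁ where
  infix  4 _≤_ _≥_
  infix  8 _⁻¹
  infixl 7 _/_
  field
    commutativeRing : CommutativeRing 0ℓ 0ℓ
  open CommutativeRing commutativeRing public
  field
    _≤_             : Rel Carrier 0ℓ
    isDecTotalOrder : IsDecTotalOrder _≈_ _≤_
    +-monoʳ-≤       : ∀ z {x y} → x ≤ y → z + x ≤ z + y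
    *-nonneg        : ∀ {x y} → 0# ≤ x → 0# ≤ y → 0# ≤ x * y
    0≉1             : 0# ≉ 1#
    -- total for convenience: 0# ⁻¹ is an unspecified element
    _⁻¹             : Carrier → Carrier
    *-inverseʳ      : ∀ x → x ≉ 0# → x * x ⁻¹ ≈ 1#

  UpperBound : Pred Carrier 0ℓ → Pred Carrier 0ℓ
  UpperBound P b = ∀ x → P x → x ≤ b

  field
    supremum : (P : Pred Carrier 0ℓ) → Satisfiable P → Satisfiable (UpperBound P) →
               ∃ λ s → UpperBound P s × (∀ b → UpperBound P b → s ≤ b)

  open IsDecTotalOrder isDecTotalOrder public
    using (total; antisym; _≟_; _≤?_; isPartialOrder; ≤-respˡ-≈; ≤-respʳ-≈)
    renaming (refl to ≤-refl; reflexive to ≤-reflexive; trans to ≤-trans)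

  _≥_ : Rel Carrier 0ℓ
  x ≥ y = y ≤ x

  _/_ : Carrier → Carrier → Carrier
  x / y = x * y ⁻¹

  fromℕ : ℕ → Carrier
  fromℕ n = Mult._×_ +-monoid n 1#

module SquareRoot (R : CompleteOrderedField) where
  open CompleteOrderedField R
  open SemiringSolver commutativeSemiring using (solve; _:=_; _:+_; _:*_; con)

  private
    poset : Poset 0ℓ 0ℓ 0ℓ
    poset = record { isPartialOrder = isPartialOrder }

  open PosetReasoning poset

  +-monoˡ-≤ : ∀ z {x y} → x ≤ y → x + z ≤ y + z
  +-monoˡ-≤ z {x} {y} p = begin
    x + z ≈⟨ +-comm x z ⟩
    z + x ≤⟨ +-monoʳ-≤ z p ⟩
    z + y ≈⟨ +-comm z y ⟩
    y + z ∎

  +-mono-≤ : ∀ {x y u v} → x ≤ y → u ≤ v → x + u ≤ y + v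
  +-mono-≤ {y = y} {u = u} p q = ≤-trans (+-monoˡ-≤ u p) (+-monoʳ-≤ y q)

  +-nonneg : ∀ {x y} → 0# ≤ x → 0# ≤ y → 0# ≤ x + y
  +-nonneg p q = ≤-trans (≤-reflexive (sym (+-identityˡ 0#))) (+-mono-≤ p q)

  x≤x+y : ∀ {x y} → 0# ≤ y → x ≤ x + y
  x≤x+y {x} q = ≤-trans (≤-reflexive (sym (+-identityʳ x))) (+-monoʳ-≤ x q)

  y≤x+y : ∀ {x y} → 0# ≤ x → y ≤ x + y
  y≤x+y {x} {y} q = ≤-trans (≤-reflexive (sym (+-identityˡ y))) (+-monoˡ-≤ y q)

  +-cancelˡ-≤ : ∀ z {x y} → z + x ≤ z + y → x ≤ y
  +-cancelˡ-≤ z {x} {y} p = begin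
    x               ≈⟨ lemma x ⟨
    - z + (z + x)   ≤⟨ +-monoʳ-≤ (- z) p ⟩
    - z + (z + y)   ≈⟨ lemma y ⟩
    y               ∎
    where
    lemma : ∀ x → - z + (z + x) ≈ x
    lemma x = trans (sym (+-assoc (- z) z x))
                    (trans (+-congʳ (-‿inverseˡ z)) (+-identityˡ x))

  x+[y-x]≈y : ∀ x y → x + (y - x) ≈ y
  x+[y-x]≈y x y =
    trans (+-comm x (y - x))
          (trans (+-assoc y (- x) x) (trans (+-congˡ (-‿inverseˡ x)) (+-identityʳ y)))

  difference : ∀ {x y} → x ≤ y → ∃ λ e → 0# ≤ e × y ≈ x + e
  difference {x} {y} p =
    y - x
    , +-cancelˡ-≤ x (≤-trans (≤-reflexive (+-identityʳ x))
                             (≤-trans p (≤-reflexive (sym (x+[y-x]≈y x y)))))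
    , sym (x+[y-x]≈y x y)

  *-monoˡ-≤ : ∀ {z x y} → 0# ≤ z → x ≤ y → z * x ≤ z * y
  *-monoˡ-≤ {z} {x} {y} 0≤z x≤y with difference x≤y
  ... | e , 0≤e , y≈x+e = begin
    z * x         ≤⟨ x≤x+y (*-nonneg 0≤z 0≤e) ⟩
    z * x + z * e ≈⟨ distribˡ z x e ⟨
    z * (x + e)   ≈⟨ *-congˡ y≈x+e ⟨
    z * y         ∎

  *-monoʳ-≤ : ∀ {z x y} → 0# ≤ z → x ≤ y → x * z ≤ y * z
  *-monoʳ-≤ {z} {x} {y} 0≤z x≤y = begin
    x * z ≈⟨ *-comm x z ⟩
    z * x ≤⟨ *-monoˡ-≤ 0≤z x≤y ⟩
    z * y ≈⟨ *-comm z y ⟩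
    y * z ∎

  0≤x*x : ∀ x → 0# ≤ x * x
  0≤x*x x with total 0# x
  ... | inj₁ 0≤x = *-nonneg 0≤x 0≤x
  ... | inj₂ x≤0 with difference x≤0
  ...   | e , 0≤e , 0≈x+e = begin
    0#              ≤⟨ *-nonneg 0≤e 0≤e ⟩
    e * e           ≈⟨ +-identityˡ (e * e) ⟨
    0# + e * e      ≈⟨ +-congʳ (trans (*-congˡ (sym 0≈x+e)) (zeroʳ x)) ⟨
    x * (x + e) + e * e
      ≈⟨ solve 2 (λ x e → x :* (x :+ e) :+ e :* e := x :* x :+ (x :+ e) :* e) refl x e ⟩
    x * x + (x + e) * e ≈⟨ +-congˡ (trans (*-congʳ (sym 0≈x+e)) (zeroˡ e)) ⟩
    x * x + 0#      ≈⟨ +-identityʳ (x * x) ⟩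
    x * x           ∎

  0≤1 : 0# ≤ 1#
  0≤1 = ≤-trans (0≤x*x 1#) (≤-reflexive (*-identityˡ 1#))

  x*x≈0⇒x≈0 : ∀ {x} → x * x ≈ 0# → x ≈ 0#
  x*x≈0⇒x≈0 {x} xx≈0 with x ≟ 0#
  ... | yes x≈0 = x≈0
  ... | no  x≉0 = begin-equality
    x              ≈⟨ *-identityʳ x ⟨
    x * 1#         ≈⟨ *-congˡ (*-inverseʳ x x≉0) ⟨
    x * (x * x ⁻¹) ≈⟨ *-assoc x x (x ⁻¹) ⟨
    x * x * x ⁻¹   ≈⟨ *-congʳ xx≈0 ⟩
    0# * x ⁻¹      ≈⟨ zeroˡ (x ⁻¹) ⟩
    0#             ∎

  square-injective : ∀ {a b} → 0# ≤ a → 0# ≤ b → a * a ≈ b * b → a ≈ b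
  square-injective {a} {b} = λ 0≤a 0≤b aa≈bb → case 0≤a 0≤b aa≈bb (total a b)
    where
    ordered : ∀ {a b} → 0# ≤ a → a * a ≈ b * b → a ≤ b → a ≈ b
    ordered {a} {b} 0≤a aa≈bb a≤b with difference a≤b
    ... | e , 0≤e , b≈a+e = trans (sym (+-identityʳ a)) (trans (+-congˡ (sym e≈0)) (sym b≈a+e))
      where
      step : a * a + (e * (a + a) + e * e) ≤ a * a + 0#
      step = begin
        a * a + (e * (a + a) + e * e)
          ≈⟨ solve 2 (λ a e → a :* a :+ (e :* (a :+ a) :+ e :* e) := (a :+ e) :* (a :+ e)) refl a e ⟩
        (a + e) * (a + e) ≈⟨ *-cong b≈a+e b≈a+e ⟨
        b * b             ≈⟨ aa≈bb ⟨
        a * a             ≈⟨ +-identityʳ (a * a) ⟨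
        a * a + 0#        ∎

      ee≤0 : e * e ≤ 0#
      ee≤0 = ≤-trans (y≤x+y (*-nonneg 0≤e (+-nonneg 0≤a 0≤a))) (+-cancelˡ-≤ (a * a) step)

      e≈0 : e ≈ 0#
      e≈0 = x*x≈0⇒x≈0 (antisym ee≤0 (0≤x*x e))

    case : 0# ≤ a → 0# ≤ b → a * a ≈ b * b → _ → a ≈ b
    case 0≤a 0≤b aa≈bb (inj₁ a≤b) = ordered 0≤a aa≈bb a≤b
    case 0≤a 0≤b aa≈bb (inj₂ b≤a) = sym (ordered 0≤b (sym aa≈bb) b≤a)

  private
    -- e divided by a number D ≥ 1
    quotient : ∀ {D e} → 1# ≤ D → 0# ≤ e →
               ∃ λ δ → 0# ≤ δ × δ * D ≈ e × (∀ {k} → e ≤ k * D → δ ≤ k)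
    quotient {D} {e} 1≤D 0≤e = e * D ⁻¹ , *-nonneg 0≤e 0≤w , δD≈e , bound
      where
      Dw≈1 : D * D ⁻¹ ≈ 1#
      Dw≈1 = *-inverseʳ D λ D≈0 → 0≉1 (antisym 0≤1 (≤-trans 1≤D (≤-reflexive D≈0)))

      0≤D : 0# ≤ D
      0≤D = ≤-trans 0≤1 1≤D

      0≤w : 0# ≤ D ⁻¹
      0≤w with total 0# (D ⁻¹)
      ... | inj₁ p = p
      ... | inj₂ p = ⊥-elim (0≉1 (antisym 0≤1 (begin
        1#         ≈⟨ Dw≈1 ⟨
        D * D ⁻¹   ≤⟨ *-monoˡ-≤ 0≤D p ⟩
        D * 0#     ≈⟨ zeroʳ D ⟩
        0#         ∎)))

      δD≈e : e * D ⁻¹ * D ≈ e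
      δD≈e = trans (*-assoc e (D ⁻¹) D)
                   (trans (*-congˡ (trans (*-comm (D ⁻¹) D) Dw≈1)) (*-identityʳ e))

      bound : ∀ {k} → e ≤ k * D → e * D ⁻¹ ≤ k
      bound {k} p = begin
        e * D ⁻¹       ≤⟨ *-monoʳ-≤ 0≤w p ⟩
        k * D * D ⁻¹   ≈⟨ *-assoc k D (D ⁻¹) ⟩
        k * (D * D ⁻¹) ≈⟨ *-congˡ Dw≈1 ⟩
        k * 1#         ≈⟨ *-identityʳ k ⟩
        k              ∎

  squareRoot : ∀ x → 0# ≤ x → ∃ λ r → 0# ≤ r × r * r ≈ x
  squareRoot x 0≤x = s , 0≤s , antisym ss≤x x≤ss
    where
    S : Pred Carrier 0ℓ
    S y = 0# ≤ y × y * y ≤ x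

    0∈S : S 0#
    0∈S = ≤-refl , ≤-trans (≤-reflexive (zeroˡ 0#)) 0≤x

    bounded : UpperBound S (1# + x)
    bounded y (0≤y , yy≤x) with total y (1# + x)
    ... | inj₁ p = p
    ... | inj₂ p = begin
      y       ≈⟨ *-identityʳ y ⟨
      y * 1#  ≤⟨ *-monoˡ-≤ 0≤y (≤-trans (x≤x+y 0≤x) p) ⟩
      y * y   ≤⟨ yy≤x ⟩
      x       ≤⟨ y≤x+y 0≤1 ⟩
      1# + x  ∎

    sup : ∃ λ s → UpperBound S s × (∀ b → UpperBound S b → s ≤ b)
    sup = supremum S (0# , 0∈S) (1# + x , bounded)

    s : Carrier
    s = proj₁ sup

    upper : UpperBound S s
    upper = proj₁ (proj₂ sup)

    least : ∀ b → UpperBound S b → s ≤ b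
    least = proj₂ (proj₂ sup)

    0≤s : 0# ≤ s
    0≤s = upper 0# 0∈S

    0≤2s : 0# ≤ s + s
    0≤2s = +-nonneg 0≤s 0≤s

    δ≤0⇒e≤0 : ∀ {D δ e} → 0# ≤ D → δ * D ≈ e → δ ≤ 0# → e ≤ 0#
    δ≤0⇒e≤0 {D} {δ} {e} 0≤D δD≈e δ≤0 = begin
      e       ≈⟨ δD≈e ⟨
      δ * D   ≤⟨ *-monoʳ-≤ 0≤D δ≤0 ⟩
      0# * D  ≈⟨ zeroˡ D ⟩
      0#      ∎

    x≤ss : x ≤ s * s
    x≤ss with total x (s * s)
    ... | inj₁ p = p
    ... | inj₂ p with difference p
    ...   | e , 0≤e , x≈ss+e
          with quotient {(s + s) + (1# + e)} {e}
                 (≤-trans (x≤x+y 0≤e) (y≤x+y 0≤2s)) 0≤e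
    ...     | δ , 0≤δ , δD≈e , δ≤ = begin
      x           ≈⟨ x≈ss+e ⟩
      s * s + e   ≤⟨ +-monoʳ-≤ (s * s) (δ≤0⇒e≤0 0≤D δD≈e δ≤0) ⟩
      s * s + 0#  ≈⟨ +-identityʳ (s * s) ⟩
      s * s       ∎
      where
      0≤D : 0# ≤ (s + s) + (1# + e)
      0≤D = +-nonneg 0≤2s (+-nonneg 0≤1 0≤e)

      δ≤1 : δ ≤ 1#
      δ≤1 = δ≤ (begin
        e                             ≤⟨ ≤-trans (y≤x+y 0≤1) (y≤x+y 0≤2s) ⟩
        (s + s) + (1# + e)            ≈⟨ *-identityˡ _ ⟨
        1# * ((s + s) + (1# + e))     ∎)

      s+δ∈S : S (s + δ)
      s+δ∈S = +-nonneg 0≤s 0≤δ , (begin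
        (s + δ) * (s + δ)
          ≈⟨ solve 2 (λ s δ → (s :+ δ) :* (s :+ δ) := s :* s :+ δ :* ((s :+ s) :+ δ)) refl s δ ⟩
        s * s + δ * ((s + s) + δ)
          ≤⟨ +-monoʳ-≤ (s * s) (*-monoˡ-≤ 0≤δ (+-monoʳ-≤ (s + s) (≤-trans δ≤1 (x≤x+y 0≤e)))) ⟩
        s * s + δ * ((s + s) + (1# + e)) ≈⟨ +-congˡ δD≈e ⟩
        s * s + e                        ≈⟨ x≈ss+e ⟨
        x                                ∎)

      δ≤0 : δ ≤ 0#
      δ≤0 = +-cancelˡ-≤ s (≤-trans (upper (s + δ) s+δ∈S) (≤-reflexive (sym (+-identityʳ s))))

    ss≤x : s * s ≤ x
    ss≤x with total (s * s) x
    ... | inj₁ p = p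
    ... | inj₂ p with difference p
    ...   | e , 0≤e , ss≈x+e
          with quotient {1# + (s + s)} {e} (x≤x+y 0≤2s) 0≤e
    ...     | δ , 0≤δ , δD≈e , δ≤ = begin
      s * s   ≈⟨ ss≈x+e ⟩
      x + e   ≤⟨ +-monoʳ-≤ x (δ≤0⇒e≤0 (+-nonneg 0≤1 0≤2s) δD≈e δ≤0) ⟩
      x + 0#  ≈⟨ +-identityʳ x ⟩
      x       ∎
      where
      δ≤s : δ ≤ s
      δ≤s = δ≤ (begin
        e                     ≤⟨ y≤x+y 0≤x ⟩
        x + e                 ≈⟨ ss≈x+e ⟨
        s * s                 ≤⟨ *-monoˡ-≤ 0≤s (≤-trans (x≤x+y 0≤s) (y≤x+y 0≤1)) ⟩
        s * (1# + (s + s))    ∎)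

      r : Carrier
      r = proj₁ (difference δ≤s)

      0≤r : 0# ≤ r
      0≤r = proj₁ (proj₂ (difference δ≤s))

      s≈δ+r : s ≈ δ + r
      s≈δ+r = proj₂ (proj₂ (difference δ≤s))

      r-bound : r * r ≤ x → δ ≤ 0#
      r-bound rr≤x = +-cancelˡ-≤ (x + δ * (s + s)) (begin
        (x + δ * (s + s)) + δ
          ≈⟨ solve 3 (λ x δ t → (x :+ δ :* t) :+ δ := x :+ δ :* (con 1 :+ t)) refl x δ (s + s) ⟩
        x + δ * (1# + (s + s))  ≈⟨ +-congˡ δD≈e ⟩
        x + e                   ≈⟨ ss≈x+e ⟨
        s * s                   ≈⟨ *-cong s≈δ+r s≈δ+r ⟩
        (δ + r) * (δ + r)
          ≈⟨ solve 2 (λ δ r → (δ :+ r) :* (δ :+ r) := r :* r :+ δ :* ((δ :+ r) :+ r)) refl δ r ⟩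
        r * r + δ * ((δ + r) + r)
          ≤⟨ +-mono-≤ rr≤x (*-monoˡ-≤ 0≤δ (+-monoʳ-≤ (δ + r) (y≤x+y 0≤δ))) ⟩
        x + δ * ((δ + r) + (δ + r)) ≈⟨ +-congˡ (*-congˡ (+-cong s≈δ+r s≈δ+r)) ⟨
        x + δ * (s + s)             ≈⟨ +-identityʳ _ ⟨
        (x + δ * (s + s)) + 0#      ∎)

      r-upper : UpperBound S r
      r-upper y (0≤y , yy≤x) with total y r
      ... | inj₁ y≤r = y≤r
      ... | inj₂ r≤y = begin
        y      ≤⟨ upper y (0≤y , yy≤x) ⟩
        s      ≈⟨ s≈δ+r ⟩
        δ + r  ≤⟨ +-monoˡ-≤ r (r-bound (≤-trans (*-monoˡ-≤ 0≤r r≤y)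
                                         (≤-trans (*-monoʳ-≤ 0≤y r≤y) yy≤x))) ⟩
        0# + r ≈⟨ +-identityˡ r ⟩
        r      ∎

      δ≤0 : δ ≤ 0#
      δ≤0 = +-cancelˡ-≤ r (begin
        r + δ   ≈⟨ +-comm r δ ⟩
        δ + r   ≈⟨ s≈δ+r ⟨
        s       ≤⟨ least r r-upper ⟩
        r       ≈⟨ +-identityʳ r ⟨
        r + 0#  ∎)

  -- √ x is 0# for negative x.
  √_ : Carrier → Carrier
  √ x with total 0# x
  ... | inj₁ 0≤x = proj₁ (squareRoot x 0≤x)
  ... | inj₂ _   = 0#

  infix 8 √_

  √-nonneg : ∀ x → 0# ≤ √ x
  √-nonneg x with total 0# x
  ... | inj₁ 0≤x = proj₁ (proj₂ (squareRoot x 0≤x))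
  ... | inj₂ _   = ≤-refl

  √x*√x≈x : ∀ {x} → 0# ≤ x → √ x * √ x ≈ x
  √x*√x≈x {x} 0≤x with total 0# x
  ... | inj₁ 0≤x′ = proj₂ (proj₂ (squareRoot x 0≤x′))
  ... | inj₂ x≤0  = trans (zeroˡ 0#) (antisym 0≤x x≤0)

  √-cong : ∀ {x y} → 0# ≤ x → x ≈ y → √ x ≈ √ y
  √-cong {x} {y} 0≤x x≈y = square-injective (√-nonneg x) (√-nonneg y)
    (trans (√x*√x≈x 0≤x) (trans x≈y (sym (√x*√x≈x (≤-respʳ-≈ x≈y 0≤x)))))

module _ (S : Setoid 0ℓ 0ℓ) where
  open Setoid S

  -- σ ∙ τ is the composite σ ∘ τ.
  symmetricGroup : Group 0ℓ 0ℓ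
  symmetricGroup = record
    { Carrier = Inverse S S
    ; _≈_     = λ σ τ → ∀ x → to σ x ≈ to τ x
    ; _∙_     = λ σ τ → Composition.inverse τ σ
    ; ε       = Identity.inverse S
    ; _⁻¹     = Symmetry.inverse
    ; isGroup = record
      { isMonoid = record
        { isSemigroup = record
          { isMagma = record
            { isEquivalence = record
              { refl  = λ x → refl
              ; sym   = λ p x → sym (p x)
              ; trans = λ p q x → trans (p x) (q x)
              }
            ; ∙-cong = λ {σ} {σ′} {τ} p q x → trans (to-cong σ (q x)) (p _)
            }
          ; assoc = λ σ τ ρ x → refl
          }
        ; identity = (λ σ x → refl) , (λ σ x → refl)
        }
      ; inverse = (λ σ x → inverseʳ σ refl) , (λ σ x → inverseˡ σ refl)
      ; ⁻¹-cong = λ {σ} {τ} p x →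
          inverseʳ σ (trans (sym (inverseˡ τ refl)) (sym (p (from τ x))))
      }
    }
    where open Inverse

record Subset (S : Setoid 0ℓ 0ℓ) : Set₁ where
  open Setoid S
  field
    pred : Pred Carrier 0ℓ
    resp : pred Respects _≈_

open Subset public

module _ {S : Setoid 0ℓ 0ℓ} where
  open Setoid S

  full : Subset S
  full = record { pred = U ; resp = λ _ p → p }

  infixr 6 _⊔_

  _⊔_ : Subset S → Subset S → Subset S
  E ⊔ F = record
    { pred = pred E ∪ pred F
    ; resp = λ { x≈y (inj₁ p) → inj₁ (resp E x≈y p) ; x≈y (inj₂ p) → inj₂ (resp F x≈y p) }
    }

module _ (G : Group 0ℓ 0ℓ) where
  open Group G

  translate : Carrier → Subset setoid → Subset setoid
  translate g E = record
    { pred = λ h → ∃ λ x → pred E x × h ≈ g ∙ x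
    ; resp = λ { h≈h′ (x , p , h≈gx) → x , p , trans (sym h≈h′) h≈gx }
    }

record LeftInvariantProbability (R : CompleteOrderedField) (G : Group 0ℓ 0ℓ) : Set₁ where
  private
    module R = CompleteOrderedField R
    module G = Group G
  field
    measure       : Subset G.setoid → R.Carrier
    cong          : ∀ E F → pred E ≐ pred F → measure E R.≈ measure F
    nonneg        : ∀ E → R.0# R.≤ measure E
    normalised    : measure full R.≈ R.1#
    additive      : ∀ E F → Empty (pred E ∩ pred F) →
                    measure (E ⊔ F) R.≈ measure E R.+ measure F
    leftInvariant : ∀ g E → measure (translate G g E) R.≈ measure E

module EuclideanPlane (R : CompleteOrderedField) where
  open CompleteOrderedField R
  open SquareRoot R

  planeSetoid : Setoid 0ℓ 0ℓ
  planeSetoid = ×-setoid setoid setoid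

  module Plane = Setoid planeSetoid

  Point : Set
  Point = Plane.Carrier

  dist : Point → Point → Carrier
  dist (x₁ , y₁) (x₂ , y₂) = √ ((x₁ - x₂) * (x₁ - x₂) + (y₁ - y₂) * (y₁ - y₂))

  dist-cong : ∀ {A A′ B B′} → A Plane.≈ A′ → B Plane.≈ B′ → dist A B ≈ dist A′ B′
  dist-cong (p , q) (p′ , q′) =
    √-cong (+-nonneg (0≤x*x _) (0≤x*x _))
      (+-cong (*-cong (minus p p′) (minus p p′)) (*-cong (minus q q′) (minus q q′)))
    where
    minus : ∀ {x x′ y y′} → x ≈ x′ → y ≈ y′ → x - y ≈ x′ - y′
    minus p q = +-cong p (-‿cong q)

  record Isometry : Set where
    field
      bijection : Inverse planeSetoid planeSetoid
    open Inverse bijection public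
    field
      isometric : ∀ A B → dist (to A) (to B) ≈ dist A B

  private module Sym = Group (symmetricGroup planeSetoid)

  euclideanGroup : Group 0ℓ 0ℓ
  euclideanGroup = record
    { Carrier = Isometry
    ; _≈_     = λ S T → bijection S Sym.≈ bijection T
    ; _∙_     = λ S T → record
      { bijection = bijection S Sym.∙ bijection T
      ; isometric = λ A B → trans (isometric S (to T A) (to T B)) (isometric T A B)
      }
    ; ε       = record { bijection = Sym.ε ; isometric = λ A B → refl }
    ; _⁻¹     = λ T → record
      { bijection = bijection T Sym.⁻¹
      ; isometric = λ A B →
          trans (sym (isometric T (from T A) (from T B)))
                (dist-cong (strictlyInverseˡ T A) (strictlyInverseˡ T B))
      }
    ; isGroup = record
      { isMonoid = record
        { isSemigroup = record
          { isMagma = record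
            { isEquivalence = record
              { refl  = λ {S} → Sym.refl {bijection S}
              ; sym   = λ {S} {T} → Sym.sym {bijection S} {bijection T}
              ; trans = λ {S} {T} {V} → Sym.trans {bijection S} {bijection T} {bijection V}
              }
            ; ∙-cong = λ {S} {S′} {T} {T′} →
                Sym.∙-cong {bijection S} {bijection S′} {bijection T} {bijection T′}
            }
          ; assoc = λ S T V → Sym.assoc (bijection S) (bijection T) (bijection V)
          }
        ; identity = (λ S → Sym.identityˡ (bijection S)) , (λ S → Sym.identityʳ (bijection S))
        }
      ; inverse = (λ S → Sym.inverseˡ (bijection S)) , (λ S → Sym.inverseʳ (bijection S))
      ; ⁻¹-cong = λ {S} {T} → Sym.⁻¹-cong {bijection S} {bijection T}
      }
    }
    where open Isometry

  Colour : Set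
  Colour = Fin 4

  colourSetoid : Setoid 0ℓ 0ℓ
  colourSetoid = ≡.setoid Colour

  record ProperColouring : Set where
    field
      colouring : Func planeSetoid colourSetoid
    open Func colouring public renaming (to to colour; cong to colour-cong)
    field
      proper : ∀ A B → dist A B ≈ 1# → colour A ≢ colour B

  S₄×E₂ : Group 0ℓ 0ℓ
  S₄×E₂ = DirectProduct.group (symmetricGroup colourSetoid) euclideanGroup

  module _ (c₀ : ProperColouring) where
    private module c₀ = ProperColouring c₀

    randomColouring : Group.Carrier S₄×E₂ → Point → Colour
    randomColouring (σ , T) A = Inverse.to σ (c₀.colour (Isometry.from T A))

    randomColouring-cong : ∀ {g h} → Group._≈_ S₄×E₂ g h →
                           ∀ A → randomColouring g A ≡ randomColouring h A
    randomColouring-cong {σ , S} {τ , T} (σ≈τ , S≈T) A =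
      ≡.trans (σ≈τ _)
        (≡.cong (Inverse.to τ)
          (c₀.colour-cong (Group.⁻¹-cong euclideanGroup {S} {T} S≈T A)))

    monochromatic : Point → Point → Subset (Group.setoid S₄×E₂)
    monochromatic A B = record
      { pred = λ g → randomColouring g A ≡ randomColouring g B
      ; resp = λ {g} {h} g≈h p →
          ≡.trans (≡.sym (randomColouring-cong {g} {h} g≈h A))
            (≡.trans p (randomColouring-cong {g} {h} g≈h B))
      }

    -- The probability p_d is monoProbability μ A B for any A, B with dist A B ≈ d.
    monoProbability : LeftInvariantProbability R S₄×E₂ → Point → Point → Carrier
    monoProbability μ A B = LeftInvariantProbability.measure μ (monochromatic A B)

-- Let O be the origin and P₀, P₁, P₂, P₃ the points of the unit circle at
-- 0°, 30°, 60°, 90°.  Among these five points two have the same colour.  All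
-- pairs are at distance 1 except P₀P₁, P₁P₂, P₂P₃, at distance d = (√6 - √2)/2,
-- and P₀P₃, at distance √2; hence 1 ≤ 3 p_d + p_√2.  In an isosceles triangle
-- with sides √2, √2, 1 the two long sides are not both monochromatic, hence
-- 2 p_√2 ≤ 1.  Together p_d ≥ 1/6, which exceeds 13/150.

module Submission where

open import Defs
open import Algebra.Bundles using (CommutativeRing; Group)
import Algebra.Properties.AbelianGroup as AbelianGroupProperties
import Algebra.Properties.CommutativeSemigroup as CommutativeSemigroupProperties
import Algebra.Properties.Ring as RingProperties
import Algebra.Properties.Semiring.Mult as SemiringMult
import Algebra.Solver.Ring as RingSolver
open import Algebra.Solver.Ring.AlmostCommutativeRing
  using (_-Raw-AlmostCommutative⟶_; fromCommutativeRing)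
open import Axiom.ExcludedMiddle using (ExcludedMiddle)
open import Data.Empty using (⊥-elim)
open import Data.Fin.Base using (Fin)
open import Data.Fin.Properties using (injective⇒≤) renaming (_≟_ to _≟ᶠ_)
open import Data.Integer.Base as ℤ using (ℤ; +_; -[1+_]; _⊖_)
import Data.Integer.Properties as ℤ
open import Data.Maybe.Base using (Maybe; map)
open import Data.Nat.Base as ℕ using (ℕ; zero; suc)
import Data.Nat.Properties as ℕ
open import Data.Product.Base using (∃; _×_; _,_; proj₁; proj₂)
open import Data.Sum.Base using (_⊎_; inj₁; inj₂; map₂)
open import Data.Vec.Base using (Vec; []; _∷_)
open import Data.Vec.Relation.Unary.All using ([]; _∷_)
open import Data.Vec.Relation.Unary.AllPairs using ([]; _∷_)
open import Data.Vec.Relation.Unary.Unique.Propositional using (Unique)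
open import Data.Vec.Relation.Unary.Unique.Propositional.Properties using (lookup-injective)
open import Function.Base using (_∘_)
open import Function.Bundles using (Inverse)
open import Level using (0ℓ)
open import Relation.Binary.Bundles using (Poset)
open import Relation.Binary.Consequences using (dec⇒weaklyDec)
import Relation.Binary.PropositionalEquality as ≡
open ≡ using (_≡_; _≢_)
import Relation.Binary.Reasoning.PartialOrder as PosetReasoning
open import Relation.Nullary using (¬_; yes; no; ¬?)
open import Relation.Nullary.Decidable using (_×-dec_; _⊎-dec_)
open import Relation.Unary using (Decidable; _⊆_; _∩_; Empty)

-- Ring solver with integer coefficients.

module IntegerCoefficientSolver {c ℓ} (R : CommutativeRing c ℓ) where
  open CommutativeRing R
  open RingProperties ring using (-‿distribˡ-*; -‿distribʳ-*; -‿involutive; -0#≈0#)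
  open AbelianGroupProperties +-abelianGroup using (⁻¹-∙-comm)
  open CommutativeSemigroupProperties +-commutativeSemigroup using (interchange)
  open SemiringMult semiring using (×-homo-+; ×1-homo-*) renaming (_×_ to _·_)

  -- Chosen so that `con (+ n)` evaluates definitionally to `fromℕ n`, and `con (+ 0)` to `0#`.
  -- Hence goals fed to the solver are phrased with `fromℕ 1`, which is `1# + 0#`, rather than with
  -- `1#`.
  ⟦_⟧ℤ : ℤ → Carrier
  ⟦ + n      ⟧ℤ = n · 1#
  ⟦ -[1+ n ] ⟧ℤ = - (suc n · 1#)

  -‿homo : ∀ i → ⟦ ℤ.- i ⟧ℤ ≈ - ⟦ i ⟧ℤ
  -‿homo (+ zero)   = sym -0#≈0#
  -‿homo (+ suc n)  = refl
  -‿homo (-[1+ n ]) = sym (-‿involutive _)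

  ⊖-homo : ∀ m n → ⟦ m ⊖ n ⟧ℤ ≈ m · 1# - n · 1#
  ⊖-homo zero    zero    = sym (-‿inverseʳ 0#)
  ⊖-homo zero    (suc n) = sym (+-identityˡ _)
  ⊖-homo (suc m) zero    = sym (trans (+-congˡ -0#≈0#) (+-identityʳ _))
  ⊖-homo (suc m) (suc n) =
    trans (reflexive (≡.cong ⟦_⟧ℤ (ℤ.[1+m]⊖[1+n]≡m⊖n m n)))
    (trans (⊖-homo m n)
    (trans (sym (+-identityˡ _))
    (trans (+-congʳ (sym (-‿inverseʳ 1#)))
    (trans (interchange 1# (- 1#) (m · 1#) (- (n · 1#)))
           (+-congˡ (⁻¹-∙-comm 1# (n · 1#)))))))

  +-homo : ∀ i j → ⟦ i ℤ.+ j ⟧ℤ ≈ ⟦ i ⟧ℤ + ⟦ j ⟧ℤ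
  +-homo (+ m)      (+ n)      = ×-homo-+ 1# m n
  +-homo (+ m)      (-[1+ n ]) = ⊖-homo m (suc n)
  +-homo (-[1+ m ]) (+ n)      = trans (⊖-homo n (suc m)) (+-comm _ _)
  +-homo (-[1+ m ]) (-[1+ n ]) =
    trans (-‿cong (trans (reflexive (≡.cong (λ k → suc k · 1#) (≡.sym (ℕ.+-suc m n))))
                         (×-homo-+ 1# (suc m) (suc n))))
          (sym (⁻¹-∙-comm _ _))

  pos-*-homo : ∀ m j → ⟦ + m ℤ.* j ⟧ℤ ≈ m · 1# * ⟦ j ⟧ℤ
  pos-*-homo m (+ n) =
    trans (reflexive (≡.cong ⟦_⟧ℤ (≡.sym (ℤ.pos-* m n)))) (×1-homo-* m n)
  pos-*-homo m (-[1+ n ]) =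
    trans (reflexive (≡.cong ⟦_⟧ℤ (≡.sym (ℤ.neg-distribʳ-* (+ m) (+ suc n)))))
    (trans (-‿homo (+ m ℤ.* + suc n))
    (trans (-‿cong (pos-*-homo m (+ suc n))) (-‿distribʳ-* _ _)))

  *-homo : ∀ i j → ⟦ i ℤ.* j ⟧ℤ ≈ ⟦ i ⟧ℤ * ⟦ j ⟧ℤ
  *-homo (+ m)      j = pos-*-homo m j
  *-homo (-[1+ m ]) j =
    trans (reflexive (≡.cong ⟦_⟧ℤ (≡.sym (ℤ.neg-distribˡ-* (+ suc m) j))))
    (trans (-‿homo (+ suc m ℤ.* j))
    (trans (-‿cong (pos-*-homo (suc m) j)) (-‿distribˡ-* _ _)))

  homomorphism : ℤ.+-*-rawRing -Raw-AlmostCommutative⟶ fromCommutativeRing R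
  homomorphism = record
    { ⟦_⟧    = ⟦_⟧ℤ
    ; +-homo = +-homo
    ; *-homo = *-homo
    ; -‿homo = -‿homo
    ; 0-homo = refl
    ; 1-homo = +-identityʳ 1#
    }

  ⟦⟧ℤ-weaklyDec : ∀ i j → Maybe (⟦ i ⟧ℤ ≈ ⟦ j ⟧ℤ)
  ⟦⟧ℤ-weaklyDec i j = map (reflexive ∘ ≡.cong ⟦_⟧ℤ) (dec⇒weaklyDec ℤ._≟_ i j)

  open RingSolver _ _ homomorphism ⟦⟧ℤ-weaklyDec public

-- Ordered-field arithmetic and the radicals √3 and (√6 - √2)/2.

module OrderedFieldProperties (R : CompleteOrderedField) where
  open CompleteOrderedField R
  open SquareRoot R
  open IntegerCoefficientSolver commutativeRing

  poset : Poset 0ℓ 0ℓ 0ℓ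
  poset = record { isPartialOrder = isPartialOrder }

  open PosetReasoning poset

  fromℕ-nonneg : ∀ n → 0# ≤ fromℕ n
  fromℕ-nonneg zero    = ≤-refl
  fromℕ-nonneg (suc n) = +-nonneg 0≤1 (fromℕ-nonneg n)

  fromℕ-suc≉0 : ∀ n → fromℕ (suc n) ≉ 0#
  fromℕ-suc≉0 n 1+n≈0 = 0≉1 (antisym 0≤1 (begin
    1#            ≤⟨ x≤x+y (fromℕ-nonneg n) ⟩
    fromℕ (suc n) ≈⟨ 1+n≈0 ⟩
    0#            ∎))

  √fromℕ-square : ∀ n → √ fromℕ n * √ fromℕ n ≈ fromℕ n
  √fromℕ-square n = √x*√x≈x (fromℕ-nonneg n)

  ⁻¹-nonneg : ∀ {x} → 0# ≤ x → x ≉ 0# → 0# ≤ x ⁻¹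
  ⁻¹-nonneg {x} 0≤x x≉0 = begin
    0#                ≤⟨ *-nonneg 0≤x (0≤x*x (x ⁻¹)) ⟩
    x * (x ⁻¹ * x ⁻¹) ≈⟨ *-assoc x (x ⁻¹) (x ⁻¹) ⟨
    x * x ⁻¹ * x ⁻¹   ≈⟨ *-congʳ (*-inverseʳ x x≉0) ⟩
    1# * x ⁻¹         ≈⟨ *-identityˡ (x ⁻¹) ⟩
    x ⁻¹              ∎

  x≈y⇒x-y≈0 : ∀ {x y} → x ≈ y → x - y ≈ 0#
  x≈y⇒x-y≈0 {x} {y} x≈y = trans (+-congʳ x≈y) (-‿inverseʳ y)

  -- Equality modulo the relation m ≈ n, certified by a cofactor k.
  mod : ∀ {x y m n} k → m ≈ n → x ≈ y + (m - n) * k → x ≈ y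
  mod {x} {y} {m} {n} k m≈n x≈ = begin-equality
    x               ≈⟨ x≈ ⟩
    y + (m - n) * k ≈⟨ +-congˡ (trans (*-congʳ (x≈y⇒x-y≈0 m≈n)) (zeroˡ k)) ⟩
    y + 0#          ≈⟨ +-identityʳ y ⟩
    y               ∎

  fromℕ1≈1 : fromℕ 1 ≈ 1#
  fromℕ1≈1 = +-identityʳ 1#

  half : Carrier
  half = fromℕ 2 ⁻¹

  2*half≈1 : fromℕ 2 * half ≈ fromℕ 1
  2*half≈1 = trans (*-inverseʳ (fromℕ 2) (fromℕ-suc≉0 1)) (sym fromℕ1≈1)

  -- √3 in the form √6 √2 / 2, so that (√6 - √2)² / 4 is 2 - √3 without comparing roots.
  √3 : Carrier
  √3 = √ fromℕ 6 * √ fromℕ 2 * half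

  √3-square : √3 * √3 ≈ fromℕ 3
  √3-square =
    -- Nested `mod`s are read from the innermost outwards: in a²b²h² first a² becomes 6, then b²
    -- becomes 2, and 12h² becomes 3 because 4h² - 1 = (2h - 1)(2h + 1). The same factorisation
    -- supplies most later cofactors of `2*half≈1`.
    mod (fromℕ 3 * (fromℕ 2 * half + fromℕ 1)) 2*half≈1
    (mod (fromℕ 6 * (half * half)) (√fromℕ-square 2)
    (mod (s₂ * s₂ * (half * half)) (√fromℕ-square 6)
    (solve 3 (λ a b h →
        a :* b :* h :* (a :* b :* h)
      := con (+ 3)
         :+ (con (+ 2) :* h :- con (+ 1)) :* (con (+ 3) :* (con (+ 2) :* h :+ con (+ 1)))
         :+ (b :* b :- con (+ 2)) :* (con (+ 6) :* (h :* h))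
         :+ (a :* a :- con (+ 6)) :* (b :* b :* (h :* h)))
      refl s₆ s₂ half)))
    where
    s₆ s₂ : Carrier
    s₆ = √ fromℕ 6
    s₂ = √ fromℕ 2

  d : Carrier
  d = (√ fromℕ 6 - √ fromℕ 2) / fromℕ 2

  d-square : d * d ≈ fromℕ 2 - √3
  d-square =
    -- After a² + b² becomes 8, the remainder is 8h² - 2abh². The first term reduces to 2 and the
    -- second to -abh, which is `- √3` by definition.
    mod (fromℕ 2 * (fromℕ 2 * half + fromℕ 1) - s₆ * s₂ * half) 2*half≈1
    (mod (half * half) (√fromℕ-square 2)
    (mod (half * half) (√fromℕ-square 6)
    (solve 3 (λ a b h →
        (a :- b) :* h :* ((a :- b) :* h)
      := con (+ 2) :- a :* b :* h
         :+ (con (+ 2) :* h :- con (+ 1))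
            :* (con (+ 2) :* (con (+ 2) :* h :+ con (+ 1)) :- a :* b :* h)
         :+ (b :* b :- con (+ 2)) :* (h :* h)
         :+ (a :* a :- con (+ 6)) :* (h :* h))
      refl s₆ s₂ half)))
    where
    s₆ s₂ : Carrier
    s₆ = √ fromℕ 6
    s₂ = √ fromℕ 2

  -- The product (2 - √3)(2 + √3) is 1, so neither factor vanishes. This squared length is later
  -- inverted to build a motion.
  2-√3≉0 : fromℕ 2 - √3 ≉ 0#
  2-√3≉0 2-√3≈0 = fromℕ-suc≉0 0
    (mod (fromℕ 1) √3-square
    (mod (fromℕ 2 + √3) 2-√3≈0
    (solve 1 (λ t →
        con (+ 1)
      := con (+ 0)
         :+ (t :* t :- con (+ 3)) :* con (+ 1)
         :+ (con (+ 2) :- t :- con (+ 0)) :* (con (+ 2) :+ t))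
      refl √3)))

-- Monotonicity and subadditivity of a finitely additive measure.

module MeasureProperties
  {R : CompleteOrderedField} {G : Group 0ℓ 0ℓ} (μ : LeftInvariantProbability R G) where
  open CompleteOrderedField R
  open SquareRoot R
  open LeftInvariantProbability μ renaming (cong to measure-cong)

  Event : Set₁
  Event = Subset (Group.setoid G)

  infixl 6 _∖_

  _∖_ : Event → Event → Event
  F ∖ E = record
    { pred = λ g → pred F g × ¬ pred E g
    ; resp = λ g≈h (p , q) → resp F g≈h p , q ∘ resp E (Group.sym G g≈h)
    }

  -- Deciding `E` sorts the elements of `F` into those already counted and the rest. The events
  -- measured below are decided by comparing colours.
  measure-⊔∖ : ∀ E F → Decidable (pred E) → measure (E ⊔ F) ≈ measure E + measure (F ∖ E)
  measure-⊔∖ E F E? =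
    trans (measure-cong (E ⊔ F) (E ⊔ (F ∖ E)) (split , merge))
          (additive E (F ∖ E) (λ { _ (p , _ , ¬p) → ¬p p }))
    where
    split : pred (E ⊔ F) ⊆ pred (E ⊔ (F ∖ E))
    split {g} p with E? g | p
    ... | yes e | _      = inj₁ e
    ... | no ¬e | inj₁ e = inj₁ e
    ... | no ¬e | inj₂ f = inj₂ (f , ¬e)

    merge : pred (E ⊔ (F ∖ E)) ⊆ pred (E ⊔ F)
    merge = map₂ proj₁

  -- The inclusion makes `E ⊔ F` the same event as `F`, so `F` exceeds `E` by the nonnegative
  -- measure of the difference.
  measure-mono : ∀ {E F} → Decidable (pred E) → pred E ⊆ pred F → measure E ≤ measure F
  measure-mono {E} {F} E? E⊆F =
    ≤-trans (x≤x+y (nonneg (F ∖ E)))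
      (≤-reflexive (trans (sym (measure-⊔∖ E F E?))
        (measure-cong (E ⊔ F) F ((λ { (inj₁ e) → E⊆F e ; (inj₂ f) → f }) , inj₂))))

  measure-subadditive : ∀ {E F} → Decidable (pred E) → Decidable (pred F) →
                        measure (E ⊔ F) ≤ measure E + measure F
  measure-subadditive {E} {F} E? F? =
    ≤-trans (≤-reflexive (measure-⊔∖ E F E?))
      (+-monoʳ-≤ (measure E) (measure-mono F∖E? proj₁))
    where
    F∖E? : Decidable (pred (F ∖ E))
    F∖E? g = F? g ×-dec ¬? (E? g)

-- Rigid motions and congruent segments.

module Geometry (R : CompleteOrderedField) where
  open CompleteOrderedField R
  open SquareRoot R
  open EuclideanPlane R
  open OrderedFieldProperties R
  open IntegerCoefficientSolver commutativeRing

  -- Polynomial in the coordinates, so distance computations stay within reach of the ring solver;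
  -- roots enter only through `dist-square` and `distSq≈1⇒dist≈1`.
  distSq : Point → Point → Carrier
  distSq (x₁ , y₁) (x₂ , y₂) = (x₁ - x₂) * (x₁ - x₂) + (y₁ - y₂) * (y₁ - y₂)

  distSq-nonneg : ∀ A B → 0# ≤ distSq A B
  distSq-nonneg _ _ = +-nonneg (0≤x*x _) (0≤x*x _)

  dist-square : ∀ A B → dist A B * dist A B ≈ distSq A B
  dist-square A B = √x*√x≈x (distSq-nonneg A B)

  distSq≈1⇒dist≈1 : ∀ {A B} → distSq A B ≈ fromℕ 1 → dist A B ≈ 1#
  distSq≈1⇒dist≈1 {A} {B} p = square-injective (√-nonneg _) 0≤1
    (trans (dist-square A B) (trans p (trans fromℕ1≈1 (sym (*-identityˡ 1#)))))

  -- The motion z ↦ u z + v of ℂ, where u = a + b i and v = v₁ + v₂ i.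
  module Motion (a b : Carrier) (∣u∣≈1 : a * a + b * b ≈ fromℕ 1) (v₁ v₂ : Carrier) where

    to from : Point → Point
    to   (x , y) = a * x - b * y + v₁ , b * x + a * y + v₂
    -- The map z ↦ ū(z - v), an inverse because uū = 1.
    from (x , y) = a * (x - v₁) + b * (y - v₂) , a * (y - v₂) - b * (x - v₁)

    private
      minus : ∀ {x x′ y y′} → x ≈ x′ → y ≈ y′ → x - y ≈ x′ - y′
      minus p q = +-cong p (-‿cong q)

    to-cong : ∀ {A B} → A Plane.≈ B → to A Plane.≈ to B
    to-cong (p , q) = +-congʳ (minus (*-congˡ p) (*-congˡ q))
                    , +-congʳ (+-cong (*-congˡ p) (*-congˡ q))

    from-cong : ∀ {A B} → A Plane.≈ B → from A Plane.≈ from B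
    from-cong (p , q) = +-cong (*-congˡ (+-congʳ p)) (*-congˡ (+-congʳ q))
                      , minus (*-congˡ (+-congʳ q)) (*-congˡ (+-congʳ p))

    to∘from : ∀ A → to (from A) Plane.≈ A
    to∘from (x , y) =
      mod (x - v₁) ∣u∣≈1 (solve 6 (λ a b v₁ v₂ x y →
          a :* (a :* (x :- v₁) :+ b :* (y :- v₂)) :- b :* (a :* (y :- v₂) :- b :* (x :- v₁)) :+ v₁
        := x :+ (a :* a :+ b :* b :- con (+ 1)) :* (x :- v₁)) refl a b v₁ v₂ x y)
      , mod (y - v₂) ∣u∣≈1 (solve 6 (λ a b v₁ v₂ x y →
          b :* (a :* (x :- v₁) :+ b :* (y :- v₂)) :+ a :* (a :* (y :- v₂) :- b :* (x :- v₁)) :+ v₂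
        := y :+ (a :* a :+ b :* b :- con (+ 1)) :* (y :- v₂)) refl a b v₁ v₂ x y)

    from∘to : ∀ A → from (to A) Plane.≈ A
    from∘to (x , y) =
      mod x ∣u∣≈1 (solve 6 (λ a b v₁ v₂ x y →
          a :* (a :* x :- b :* y :+ v₁ :- v₁) :+ b :* (b :* x :+ a :* y :+ v₂ :- v₂)
        := x :+ (a :* a :+ b :* b :- con (+ 1)) :* x) refl a b v₁ v₂ x y)
      , mod y ∣u∣≈1 (solve 6 (λ a b v₁ v₂ x y →
          a :* (b :* x :+ a :* y :+ v₂ :- v₂) :- b :* (a :* x :- b :* y :+ v₁ :- v₁)
        := y :+ (a :* a :+ b :* b :- con (+ 1)) :* y) refl a b v₁ v₂ x y)

    to-distSq : ∀ A B → distSq (to A) (to B) ≈ distSq A B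
    to-distSq (x₁ , y₁) (x₂ , y₂) =
      trans (+-cong (square-cong dx) (square-cong dy))
        -- The translation has cancelled; what remains is |uw|² = |u|²|w|² for w = X + Yi.
        (mod (X * X + Y * Y) ∣u∣≈1 (solve 4 (λ a b X Y →
            (a :* X :- b :* Y) :* (a :* X :- b :* Y) :+ (b :* X :+ a :* Y) :* (b :* X :+ a :* Y)
          := X :* X :+ Y :* Y :+ (a :* a :+ b :* b :- con (+ 1)) :* (X :* X :+ Y :* Y))
          refl a b X Y))
      where
      X Y : Carrier
      X = x₁ - x₂
      Y = y₁ - y₂

      square-cong : ∀ {x y} → x ≈ y → x * x ≈ y * y
      square-cong p = *-cong p p

      dx : a * x₁ - b * y₁ + v₁ - (a * x₂ - b * y₂ + v₁) ≈ a * X - b * Y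
      dx = solve 7 (λ a b v x₁ y₁ x₂ y₂ →
          a :* x₁ :- b :* y₁ :+ v :- (a :* x₂ :- b :* y₂ :+ v)
        := a :* (x₁ :- x₂) :- b :* (y₁ :- y₂)) refl a b v₁ x₁ y₁ x₂ y₂

      dy : b * x₁ + a * y₁ + v₂ - (b * x₂ + a * y₂ + v₂) ≈ b * X + a * Y
      dy = solve 7 (λ a b v x₁ y₁ x₂ y₂ →
          b :* x₁ :+ a :* y₁ :+ v :- (b :* x₂ :+ a :* y₂ :+ v)
        := b :* (x₁ :- x₂) :+ a :* (y₁ :- y₂)) refl a b v₂ x₁ y₁ x₂ y₂

    isometry : Isometry
    isometry = record
      { bijection = record
        { to        = to
        ; from      = from
        ; to-cong   = to-cong
        ; from-cong = from-cong
        ; inverse   = (λ p → Plane.trans (to-cong p) (to∘from _))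
                    , (λ p → Plane.trans (from-cong p) (from∘to _))
        }
      ; isometric = λ A B → √-cong (distSq-nonneg (to A) (to B)) (to-distSq A B)
      }

  -- Over ℂ the motion is z ↦ uz + v with u = (C - D)/(A - B) and v = C - uA. Since |A - B|² = n,
  -- the quotient u is the conjugate of A - B times C - D, divided by n; `a` and `b` are its real
  -- and imaginary parts.
  congruent-segments : ∀ {n} A B C D → n ≉ 0# → distSq A B ≈ n → distSq C D ≈ n →
    ∃ λ T → Isometry.to T A Plane.≈ C × Isometry.to T B Plane.≈ D
  congruent-segments {n} (x₁ , y₁) (x₂ , y₂) (x₃ , y₃) (x₄ , y₄) n≉0 AB≈n CD≈n =
    isometry , (toA₁ , toA₂) , (toB₁ , toB₂)
    where
    p q r s i a b v₁ v₂ : Carrier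
    p  = x₁ - x₂
    q  = y₁ - y₂
    r  = x₃ - x₄
    s  = y₃ - y₄
    i  = n ⁻¹
    a  = (p * r + q * s) * i
    b  = (p * s - q * r) * i
    v₁ = x₃ - (a * x₁ - b * y₁)
    v₂ = y₃ - (b * x₁ + a * y₁)

    ni≈1 : n * i ≈ fromℕ 1
    ni≈1 = trans (*-inverseʳ n n≉0) (sym fromℕ1≈1)

    ∣u∣≈1 : a * a + b * b ≈ fromℕ 1
    ∣u∣≈1 =
      -- The left side is |A - B|²|C - D|²i². Both squared lengths become n, leaving (ni)² = 1 + (ni
      -- - 1)(ni + 1).
      mod (n * i + fromℕ 1) ni≈1
      (mod (n * (i * i)) AB≈n
      (mod ((p * p + q * q) * (i * i)) CD≈n
      (solve 6 (λ p q r s i n →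
          (p :* r :+ q :* s) :* i :* ((p :* r :+ q :* s) :* i)
          :+ (p :* s :- q :* r) :* i :* ((p :* s :- q :* r) :* i)
        := con (+ 1)
           :+ (n :* i :- con (+ 1)) :* (n :* i :+ con (+ 1))
           :+ (p :* p :+ q :* q :- n) :* (n :* (i :* i))
           :+ (r :* r :+ s :* s :- n) :* ((p :* p :+ q :* q) :* (i :* i)))
        refl p q r s i n)))

    open Motion a b ∣u∣≈1 v₁ v₂

    toA₁ : a * x₁ - b * y₁ + v₁ ≈ x₃
    toA₁ = x+[y-x]≈y _ x₃

    toA₂ : b * x₁ + a * y₁ + v₂ ≈ y₃
    toA₂ = x+[y-x]≈y _ y₃

    -- With `bp+aq≈s`, the two coordinates of u(A - B) = C - D.
    ap-bq≈r : a * p - b * q ≈ r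
    ap-bq≈r =
      mod r ni≈1
      (mod (i * r) AB≈n
      (solve 6 (λ p q r s i n →
          (p :* r :+ q :* s) :* i :* p :- (p :* s :- q :* r) :* i :* q
        := r :+ (n :* i :- con (+ 1)) :* r :+ (p :* p :+ q :* q :- n) :* (i :* r))
        refl p q r s i n))

    bp+aq≈s : b * p + a * q ≈ s
    bp+aq≈s =
      mod s ni≈1
      (mod (i * s) AB≈n
      (solve 6 (λ p q r s i n →
          (p :* s :- q :* r) :* i :* p :+ (p :* r :+ q :* s) :* i :* q
        := s :+ (n :* i :- con (+ 1)) :* s :+ (p :* p :+ q :* q :- n) :* (i :* s))
        refl p q r s i n))

    toB₁ : a * x₂ - b * y₂ + v₁ ≈ x₄
    -- uB + v = C - u(A - B), which is D; the minus sign is the cofactor.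
    toB₁ = mod (- fromℕ 1) ap-bq≈r (solve 8 (λ a b x₁ y₁ x₂ y₂ x₃ x₄ →
        a :* x₂ :- b :* y₂ :+ (x₃ :- (a :* x₁ :- b :* y₁))
      := x₄ :+ (a :* (x₁ :- x₂) :- b :* (y₁ :- y₂) :- (x₃ :- x₄)) :* (:- con (+ 1)))
      refl a b x₁ y₁ x₂ y₂ x₃ x₄)

    toB₂ : b * x₂ + a * y₂ + v₂ ≈ y₄
    toB₂ = mod (- fromℕ 1) bp+aq≈s (solve 8 (λ a b x₁ y₁ x₂ y₂ y₃ y₄ →
        b :* x₂ :+ a :* y₂ :+ (y₃ :- (b :* x₁ :+ a :* y₁))
      := y₄ :+ (b :* (x₁ :- x₂) :+ a :* (y₁ :- y₂) :- (y₃ :- y₄)) :* (:- con (+ 1)))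
      refl a b x₁ y₁ x₂ y₂ y₃ y₄)

-- Coordinates and distances of the two point configurations.

module Configuration (R : CompleteOrderedField) where
  open CompleteOrderedField R
  open SquareRoot R
  open EuclideanPlane R
  open OrderedFieldProperties R
  open Geometry R
  open IntegerCoefficientSolver commutativeRing

  O P₀ P₁ P₂ P₃ : Point
  O  = 0# , 0#
  P₀ = fromℕ 1 , 0#
  P₁ = √3 * half , half
  P₂ = half , √3 * half
  P₃ = 0# , fromℕ 1

  OP₀≈1 : distSq O P₀ ≈ fromℕ 1
  OP₀≈1 = solve 0 ((con (+ 0) :- con (+ 1)) :* (con (+ 0) :- con (+ 1))
                     :+ (con (+ 0) :- con (+ 0)) :* (con (+ 0) :- con (+ 0))
                   := con (+ 1)) refl

  OP₁≈1 : distSq O P₁ ≈ fromℕ 1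
  OP₁≈1 =
    mod (fromℕ 2 * half + fromℕ 1) 2*half≈1
    (mod (half * half) √3-square
    (solve 2 (λ t h →
        (con (+ 0) :- t :* h) :* (con (+ 0) :- t :* h) :+ (con (+ 0) :- h) :* (con (+ 0) :- h)
      := con (+ 1)
         :+ (con (+ 2) :* h :- con (+ 1)) :* (con (+ 2) :* h :+ con (+ 1))
         :+ (t :* t :- con (+ 3)) :* (h :* h))
      refl √3 half))

  -- A 30° chord of the unit circle has squared length 2 - 2 cos 30°.
  P₀P₁≈2-√3 : distSq P₀ P₁ ≈ fromℕ 2 - √3
  P₀P₁≈2-√3 =
    mod (fromℕ 2 * half + fromℕ 1 - √3) 2*half≈1
    (mod (half * half) √3-square
    (solve 2 (λ t h →
        (con (+ 1) :- t :* h) :* (con (+ 1) :- t :* h) :+ (con (+ 0) :- h) :* (con (+ 0) :- h)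
      := con (+ 2) :- t
         :+ (con (+ 2) :* h :- con (+ 1)) :* (con (+ 2) :* h :+ con (+ 1) :- t)
         :+ (t :* t :- con (+ 3)) :* (h :* h))
      refl √3 half))

  P₁P₂≈2-√3 : distSq P₁ P₂ ≈ fromℕ 2 - √3
  P₁P₂≈2-√3 =
    mod ((fromℕ 2 - √3) * (fromℕ 2 * half + fromℕ 1)) 2*half≈1
    (mod (fromℕ 2 * (half * half)) √3-square
    (solve 2 (λ t h →
        (t :* h :- h) :* (t :* h :- h) :+ (h :- t :* h) :* (h :- t :* h)
      := con (+ 2) :- t
         :+ (con (+ 2) :* h :- con (+ 1)) :* ((con (+ 2) :- t) :* (con (+ 2) :* h :+ con (+ 1)))
         :+ (t :* t :- con (+ 3)) :* (con (+ 2) :* (h :* h)))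
      refl √3 half))

  P₀P₂≈1 : distSq P₀ P₂ ≈ fromℕ 1
  P₀P₂≈1 =
    mod (fromℕ 2 * half) 2*half≈1
    (mod (half * half) √3-square
    (solve 2 (λ t h →
        (con (+ 1) :- h) :* (con (+ 1) :- h) :+ (con (+ 0) :- t :* h) :* (con (+ 0) :- t :* h)
      := con (+ 1)
         :+ (con (+ 2) :* h :- con (+ 1)) :* (con (+ 2) :* h)
         :+ (t :* t :- con (+ 3)) :* (h :* h))
      refl √3 half))

  P₀P₃≈2 : distSq P₀ P₃ ≈ fromℕ 2
  P₀P₃≈2 = solve 0 ((con (+ 1) :- con (+ 0)) :* (con (+ 1) :- con (+ 0))
                      :+ (con (+ 0) :- con (+ 1)) :* (con (+ 0) :- con (+ 1))
                    := con (+ 2)) refl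

  -- Reflection in the diagonal fixes `O` and exchanges `P₀` with `P₃` and `P₁` with `P₂`, all
  -- definitionally, so the remaining distances follow from those above.
  transpose : Point → Point
  transpose (x , y) = y , x

  transpose-distSq : ∀ {n} A B → distSq A B ≈ n → distSq (transpose A) (transpose B) ≈ n
  transpose-distSq _ _ = trans (+-comm _ _)

  distSq-sym : ∀ {n} A B → distSq A B ≈ n → distSq B A ≈ n
  distSq-sym (x₁ , y₁) (x₂ , y₂) = trans (solve 4 (λ x₁ y₁ x₂ y₂ →
      (x₂ :- x₁) :* (x₂ :- x₁) :+ (y₂ :- y₁) :* (y₂ :- y₁)
    := (x₁ :- x₂) :* (x₁ :- x₂) :+ (y₁ :- y₂) :* (y₁ :- y₂)) refl x₁ y₁ x₂ y₂)

  OP₂≈1 : distSq O P₂ ≈ fromℕ 1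
  OP₂≈1 = transpose-distSq O P₁ OP₁≈1

  OP₃≈1 : distSq O P₃ ≈ fromℕ 1
  OP₃≈1 = transpose-distSq O P₀ OP₀≈1

  P₁P₃≈1 : distSq P₁ P₃ ≈ fromℕ 1
  P₁P₃≈1 = distSq-sym P₃ P₁ (transpose-distSq P₀ P₂ P₀P₂≈1)

  P₂P₃≈2-√3 : distSq P₂ P₃ ≈ fromℕ 2 - √3
  P₂P₃≈2-√3 = distSq-sym P₃ P₂ (transpose-distSq P₀ P₁ P₀P₁≈2-√3)

  -- The height √(2 - 1/4) of the isosceles triangle with sides √2, √2, 1, whose apex is `Q` and
  -- whose base is `L M`.
  √7/2 : Carrier
  √7/2 = √ fromℕ 7 * half

  Q L M : Point
  Q = 0# , √7/2
  L = half , 0#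
  M = - half , 0#

  private
    7/4-square : √7/2 * √7/2 ≈ fromℕ 7 * (half * half)
    7/4-square = mod (half * half) (√fromℕ-square 7) (solve 2 (λ s h →
      s :* h :* (s :* h) := con (+ 7) :* (h :* h) :+ (s :* s :- con (+ 7)) :* (h :* h))
      refl (√ fromℕ 7) half)

  QL≈2 : distSq Q L ≈ fromℕ 2
  QL≈2 =
    mod (fromℕ 2 * (fromℕ 2 * half + fromℕ 1)) 2*half≈1
    (mod (fromℕ 1) 7/4-square
    (solve 2 (λ s h →
        (con (+ 0) :- h) :* (con (+ 0) :- h) :+ (s :- con (+ 0)) :* (s :- con (+ 0))
      := con (+ 2)
         :+ (con (+ 2) :* h :- con (+ 1)) :* (con (+ 2) :* (con (+ 2) :* h :+ con (+ 1)))
         :+ (s :* s :- con (+ 7) :* (h :* h)) :* con (+ 1))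
      refl √7/2 half))

  QM≈2 : distSq Q M ≈ fromℕ 2
  QM≈2 = trans (solve 2 (λ s h →
        (con (+ 0) :- (:- h)) :* (con (+ 0) :- (:- h)) :+ (s :- con (+ 0)) :* (s :- con (+ 0))
      := (con (+ 0) :- h) :* (con (+ 0) :- h) :+ (s :- con (+ 0)) :* (s :- con (+ 0)))
      refl √7/2 half) QL≈2

  LM≈1 : distSq L M ≈ fromℕ 1
  LM≈1 = mod (fromℕ 2 * half + fromℕ 1) 2*half≈1 (solve 1 (λ h →
      (h :- (:- h)) :* (h :- (:- h)) :+ (con (+ 0) :- con (+ 0)) :* (con (+ 0) :- con (+ 0))
    := con (+ 1) :+ (con (+ 2) :* h :- con (+ 1)) :* (con (+ 2) :* h :+ con (+ 1)))
    refl half)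

-- Pigeonhole with four colours.

unique⇒length≤ : ∀ {m n} {xs : Vec (Fin m) n} → Unique xs → n ℕ.≤ m
unique⇒length≤ unique = injective⇒≤ (λ {i} {j} → lookup-injective unique i j)

-- The six hypotheses are the unit distances among `O`, `P₀`, `P₁`, `P₂`, `P₃`; the conclusion lists
-- the other four of the ten pairs.
four-colours : ∀ {o a b c d : Fin 4} → o ≢ a → o ≢ b → o ≢ c → o ≢ d → a ≢ c → b ≢ d →
               a ≡ b ⊎ b ≡ c ⊎ c ≡ d ⊎ a ≡ d
four-colours {o} {a} {b} {c} {d} oa ob oc od ac bd
  with a ≟ᶠ b | b ≟ᶠ c | c ≟ᶠ d | a ≟ᶠ d
... | yes ab | _      | _      | _      = inj₁ ab
... | no  _  | yes bc | _      | _      = inj₂ (inj₁ bc)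
... | no  _  | no  _  | yes cd | _      = inj₂ (inj₂ (inj₁ cd))
... | no  _  | no  _  | no  _  | yes ad = inj₂ (inj₂ (inj₂ ad))
-- All ten pairs now differ, which gives 5 ≤ 4, and that unfolds to 4 < 4.
... | no  ab | no  bc | no  cd | no  ad = ⊥-elim (ℕ.<-irrefl ≡.refl (unique⇒length≤ unique))
  where
  unique : Unique (o ∷ a ∷ b ∷ c ∷ d ∷ [])
  unique = (oa ∷ ob ∷ oc ∷ od ∷ []) ∷ (ab ∷ ac ∷ ad ∷ []) ∷ (bc ∷ bd ∷ []) ∷ (cd ∷ []) ∷ [] ∷ []

-- Probabilities of monochromatic pairs.

module RandomColouring
  (R : CompleteOrderedField) (c₀ : EuclideanPlane.ProperColouring R)
  (μ : LeftInvariantProbability R (EuclideanPlane.S₄×E₂ R)) where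
  open CompleteOrderedField R
  open SquareRoot R
  open EuclideanPlane R
  open OrderedFieldProperties R
  open Geometry R
  open Configuration R
  open IntegerCoefficientSolver commutativeRing using (solve; _:=_; _:+_; _:*_; con)
  open MeasureProperties μ
  open LeftInvariantProbability μ renaming (cong to measure-cong)
  open PosetReasoning poset

  private
    module c₀ = ProperColouring c₀
    module G = Group S₄×E₂
    module S₄ = Group (symmetricGroup colourSetoid)

  mono : Point → Point → Event
  mono = monochromatic c₀

  p : Point → Point → Carrier
  p = monoProbability c₀ μ

  mono? : ∀ A B → Decidable (pred (mono A B))
  mono? A B g = _ ≟ᶠ _

  randomColouring-resp : ∀ g {A B} → A Plane.≈ B → randomColouring c₀ g A ≡ randomColouring c₀ g B
  randomColouring-resp (σ , T) A≈B =
    ≡.cong (Inverse.to σ) (c₀.colour-cong (Isometry.from-cong T A≈B))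

  -- The inverse of T preserves the unit distance and σ is injective, so properness of `c₀` carries
  -- over.
  randomColouring-proper : ∀ g {A B} → distSq A B ≈ fromℕ 1 →
                           randomColouring c₀ g A ≢ randomColouring c₀ g B
  randomColouring-proper (σ , T) {A} {B} AB≈1 σa≡σb =
    c₀.proper (Isometry.from T A) (Isometry.from T B)
      (trans (Isometry.isometric (Group._⁻¹ euclideanGroup T) A B) (distSq≈1⇒dist≈1 AB≈1))
      (≡.trans (≡.sym (Inverse.strictlyInverseʳ σ _))
        (≡.trans (≡.cong (Inverse.from σ) σa≡σb) (Inverse.strictlyInverseʳ σ _)))

  p-cong : ∀ {A A′ B B′} → A Plane.≈ A′ → B Plane.≈ B′ → p A B ≈ p A′ B′
  p-cong {A} {A′} {B} {B′} A≈A′ B≈B′ = measure-cong (mono A B) (mono A′ B′)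
    ( (λ {g} q → ≡.trans (≡.sym (colourA g)) (≡.trans q (colourB g)))
    , (λ {g} q → ≡.trans (colourA g) (≡.trans q (≡.sym (colourB g)))))
    where
    colourA : ∀ g → randomColouring c₀ g A ≡ randomColouring c₀ g A′
    colourA g = randomColouring-resp g {A} {A′} A≈A′

    colourB : ∀ g → randomColouring c₀ g B ≡ randomColouring c₀ g B′
    colourB g = randomColouring-resp g {B} {B′} B≈B′

  -- Left multiplication by g = (id, T) moves a colouring along T: under gx the point TC has the
  -- colour that C has under x. Thus the event for TA, TB is the g-translate of the event for A, B.
  p-invariant : ∀ T A B → p (Isometry.to T A) (Isometry.to T B) ≈ p A B
  p-invariant T A B =
    trans (measure-cong (mono TA TB) (translate S₄×E₂ g (mono A B))
            ((λ {h} → ⊆-translate {h}) , (λ {h} → translate-⊆ {h})))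
          (leftInvariant g (mono A B))
    where
    TA TB : Point
    TA = Isometry.to T A
    TB = Isometry.to T B

    g : G.Carrier
    g = S₄.ε , T

    ⊆-translate : pred (mono TA TB) ⊆ pred (translate S₄×E₂ g (mono A B))
    -- The colour of A under g⁻¹h unfolds to that of TA under h, so `q` serves unchanged; the rest
    -- is g(g⁻¹h) = h.
    ⊆-translate {h} q = g G.⁻¹ G.∙ h , q ,
      G.sym {g G.∙ (g G.⁻¹ G.∙ h)} {h}
        (G.trans {g G.∙ (g G.⁻¹ G.∙ h)} {g G.∙ g G.⁻¹ G.∙ h} {h}
          (G.sym {g G.∙ g G.⁻¹ G.∙ h} {g G.∙ (g G.⁻¹ G.∙ h)} (G.assoc g (g G.⁻¹) h))
          (G.trans {g G.∙ g G.⁻¹ G.∙ h} {G.ε G.∙ h} {h}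
            (G.∙-congʳ {h} {g G.∙ g G.⁻¹} {G.ε} (G.inverseʳ g)) (G.identityˡ h)))

    randomColouring-g∙ : ∀ x C → randomColouring c₀ (g G.∙ x) (Isometry.to T C) ≡ randomColouring c₀ x C
    randomColouring-g∙ x C =
      randomColouring-resp x {Isometry.from T (Isometry.to T C)} {C} (Isometry.strictlyInverseʳ T C)

    translate-⊆ : pred (translate S₄×E₂ g (mono A B)) ⊆ pred (mono TA TB)
    translate-⊆ {h} (x , q , h≈gx) = resp (mono TA TB) {g G.∙ x} {h}
      (G.sym {h} {g G.∙ x} h≈gx)
      (≡.trans (randomColouring-g∙ x A) (≡.trans q (≡.sym (randomColouring-g∙ x B))))

  -- Makes p_d well defined for nonzero lengths, by moving one segment onto the other.
  p-congruent : ∀ {n} A B C D → n ≉ 0# → distSq A B ≈ n → distSq C D ≈ n → p A B ≈ p C D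
  p-congruent A B C D n≉0 AB≈n CD≈n =
    trans (sym (p-invariant T A B))
      (p-cong {Isometry.to T A} {C} {Isometry.to T B} {D} TA≈C TB≈D)
    where
    motion : ∃ λ T → Isometry.to T A Plane.≈ C × Isometry.to T B Plane.≈ D
    motion = congruent-segments A B C D n≉0 AB≈n CD≈n

    T : Isometry
    T = proj₁ motion

    TA≈C : Isometry.to T A Plane.≈ C
    TA≈C = proj₁ (proj₂ motion)

    TB≈D : Isometry.to T B Plane.≈ D
    TB≈D = proj₂ (proj₂ motion)

  -- The events on the two long sides of `Q L M` are disjoint, since `L` and `M` differ in colour.
  -- The doubled form avoids a division.
  p[√2]≤1/2 : p P₀ P₃ + p P₀ P₃ ≤ 1#
  p[√2]≤1/2 = begin
    p P₀ P₃ + p P₀ P₃         ≈⟨ +-cong (p-congruent P₀ P₃ Q L 2≉0 P₀P₃≈2 QL≈2)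
                                        (p-congruent P₀ P₃ Q M 2≉0 P₀P₃≈2 QM≈2) ⟩
    p Q L + p Q M             ≈⟨ additive (mono Q L) (mono Q M) disjoint ⟨
    measure (mono Q L ⊔ mono Q M)
      ≤⟨ measure-mono (λ g → mono? Q L g ⊎-dec mono? Q M g) (λ _ → _) ⟩
    measure full              ≈⟨ normalised ⟩
    1#                        ∎
    where
    2≉0 : fromℕ 2 ≉ 0#
    2≉0 = fromℕ-suc≉0 1

    disjoint : Empty (pred (mono Q L) ∩ pred (mono Q M))
    disjoint g (q , r) = randomColouring-proper g LM≈1 (≡.trans (≡.sym q) r)

  -- Union bound over the alternatives of `four-colours`; the events are nested to the right so that
  -- its conclusion is literally membership in their union.
  1≤3p[d]+p[√2] : 1# ≤ p P₀ P₁ + (p P₁ P₂ + (p P₂ P₃ + p P₀ P₃))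
  1≤3p[d]+p[√2] = begin
    1#               ≈⟨ normalised ⟨
    measure full     ≤⟨ measure-mono (λ _ → yes _) (λ {g} _ → covered g) ⟩
    measure (mono P₀ P₁ ⊔ E)          ≤⟨ measure-subadditive (mono? P₀ P₁) E? ⟩
    p P₀ P₁ + measure E               ≤⟨ +-monoʳ-≤ _ (measure-subadditive (mono? P₁ P₂) F?) ⟩
    p P₀ P₁ + (p P₁ P₂ + measure F)   ≤⟨ +-monoʳ-≤ _ (+-monoʳ-≤ _
                                           (measure-subadditive (mono? P₂ P₃) (mono? P₀ P₃))) ⟩
    p P₀ P₁ + (p P₁ P₂ + (p P₂ P₃ + p P₀ P₃)) ∎
    where
    E F : Event
    F = mono P₂ P₃ ⊔ mono P₀ P₃
    E = mono P₁ P₂ ⊔ F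

    F? : Decidable (pred F)
    F? g = mono? P₂ P₃ g ⊎-dec mono? P₀ P₃ g

    E? : Decidable (pred E)
    E? g = mono? P₁ P₂ g ⊎-dec F? g

    covered : ∀ g → pred (mono P₀ P₁ ⊔ E) g
    covered g = four-colours
      (proper OP₀≈1) (proper OP₁≈1) (proper OP₂≈1) (proper OP₃≈1) (proper P₀P₂≈1) (proper P₁P₃≈1)
      where
      c : Point → Colour
      c = randomColouring c₀ g

      proper : ∀ {A B} → distSq A B ≈ fromℕ 1 → c A ≢ c B
      proper = randomColouring-proper g

  1≤6p[d] : ∀ A B → dist A B ≈ d → fromℕ 1 ≤ fromℕ 6 * p A B
  1≤6p[d] A B AB≈d = +-cancelˡ-≤ (fromℕ 1) (begin
    fromℕ 1 + fromℕ 1                     ≈⟨ +-cong fromℕ1≈1 fromℕ1≈1 ⟩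
    1# + 1#                               ≤⟨ +-mono-≤ 1≤3p+q 1≤3p+q ⟩
    -- Doubling 1 ≤ 3p + q produces 2q, which is at most 1: 2 ≤ 6p + 2q ≤ 6p + 1.
    3p+q + 3p+q                           ≈⟨ solve 2 (λ p q →
        (p :+ (p :+ (p :+ q))) :+ (p :+ (p :+ (p :+ q))) := (q :+ q) :+ con (+ 6) :* p)
        refl (p A B) q ⟩
    (q + q) + fromℕ 6 * p A B             ≤⟨ +-monoˡ-≤ _ p[√2]≤1/2 ⟩
    1# + fromℕ 6 * p A B                  ≈⟨ +-congʳ fromℕ1≈1 ⟨
    fromℕ 1 + fromℕ 6 * p A B             ∎)
    where
    q 3p+q : Carrier
    q    = p P₀ P₃
    3p+q = p A B + (p A B + (p A B + q))

    p[d] : ∀ C D → distSq C D ≈ fromℕ 2 - √3 → p C D ≈ p A B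
    p[d] C D CD≈ = p-congruent C D A B 2-√3≉0 CD≈
      (trans (sym (dist-square A B)) (trans (*-cong AB≈d AB≈d) d-square))

    1≤3p+q : 1# ≤ 3p+q
    1≤3p+q = ≤-respʳ-≈
      (+-cong (p[d] P₀ P₁ P₀P₁≈2-√3)
        (+-cong (p[d] P₁ P₂ P₁P₂≈2-√3) (+-congʳ (p[d] P₂ P₃ P₂P₃≈2-√3))))
      1≤3p[d]+p[√2]

  13/150≤p[d] : ∀ A B → dist A B ≈ d → fromℕ 13 / fromℕ 150 ≤ p A B
  13/150≤p[d] A B AB≈d = begin
    -- The bound proved is 1/6 = 25/150, and 12 is the slack between 13 and 25.
    fromℕ 13 * i                          ≤⟨ *-monoʳ-≤ 0≤i (x≤x+y (fromℕ-nonneg 12)) ⟩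
    (fromℕ 13 + fromℕ 12) * i             ≈⟨ *-congʳ (solve 0
        (con (+ 13) :+ con (+ 12) := con (+ 25) :* con (+ 1)) refl) ⟩
    fromℕ 25 * fromℕ 1 * i                ≤⟨ *-monoʳ-≤ 0≤i
        (*-monoˡ-≤ (fromℕ-nonneg 25) (1≤6p[d] A B AB≈d)) ⟩
    fromℕ 25 * (fromℕ 6 * p A B) * i      ≈⟨ solve 2 (λ p i →
        con (+ 25) :* (con (+ 6) :* p) :* i := con (+ 150) :* i :* p) refl (p A B) i ⟩
    fromℕ 150 * i * p A B                 ≈⟨ *-congʳ (*-inverseʳ _ (fromℕ-suc≉0 149)) ⟩
    1# * p A B                            ≈⟨ *-identityˡ _ ⟩
    p A B                                 ∎
    where
    i : Carrier
    i = fromℕ 150 ⁻¹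

    0≤i : 0# ≤ i
    0≤i = ⁻¹-nonneg (fromℕ-nonneg 150) (fromℕ-suc≉0 149)

mainTheorem4 : ExcludedMiddle 0ℓ → (R : CompleteOrderedField) →
    let open CompleteOrderedField R
        open SquareRoot R
        open EuclideanPlane R
    in (c₀ : ProperColouring) (μ : LeftInvariantProbability R S₄×E₂) →
       ∀ A B → dist A B ≈ (√ fromℕ 6 - √ fromℕ 2) / fromℕ 2 →
       monoProbability c₀ μ A B ≥ fromℕ 13 / fromℕ 150
mainTheorem4 _ R c₀ μ A B = RandomColouring.13/150≤p[d] R c₀ μ A B
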